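{- Let $\mathbf{K}$ be a regular variety of $\Sigma$-structures satisfying the amalgamation property. Then any logic $l$ over $\Sigma$ with an algebraic semantics in $\mathbf{K}$ given by a regular equation satisfies the Craig interpolation property.
   Context: $Fm(X)$ is the absolutely free $\Sigma$-structure (formula algebra) on a set $X$ of variables. A logic over $\Sigma$ is a pair $l=(\Sigma,\vdash_l)$ with $\vdash_l$ a reflexive, monotone, cut-closed, finitary and substitution-invariant consequence relation on $Fm(X)$. An equation is a pair of formulas $\langle\varphi,\psi\rangle$, also written $\varphi\approx\psi$; it is regular if $\varphi$ and $\psi$ contain exactly the same variables. A variety is regular if it can be defined by regular equations. $l$ has an algebraic semantics in $\mathbf{K}$ given by an equation $\delta(x)\approx\epsilon(x)$ (in at most the variable $x$) if for all $\Gamma\cup\{\varphi\}\subseteq Fm(X)$: $\Gamma\vdash_l\varphi$ iff $\{\delta(\gamma)\approx\epsilon(\gamma)\mid\gamma\in\Gamma\}\models_{\mathbf{K}}\delta(\varphi)\approx\epsilon(\varphi)$, where $\Theta\models_{\mathbf{K}}\varphi\approx\psi$ means that for every $A\in\mathbf{K}$ and every homomorphism $h:Fm(X)\to A$ with $h(\eta)=h(\nu)$ for all $\eta\approx\nu$ in $\Theta$ one has $h(\varphi)=h(\psi)$. Amalgamation property of $\mathbf{K}$: for all $A,B,C\in\mathbf{K}$ and injective homomorphisms $i_B:A\to B$, $i_C:A\to C$ there are $D\in\mathbf{K}$ and injective homomorphisms $e_B:B\to D$, $e_C:C\to D$ with $e_B\circ i_B=e_C\circ i_C$. Craig (entailment)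 interpolation property: for every set of formulas $\Gamma$ and every formula $\varphi$, if $\Gamma\vdash_l\varphi$ then there is a set of formulas $\Gamma'$ with variables in $var(\Gamma)\cap var(\varphi)$ such that $\Gamma\vdash_l\gamma'$ for all $\gamma'\in\Gamma'$ and $\Gamma'\vdash_l\varphi$. Here $var$ denotes the set of variables occurring. -}

module Defs where

open import Level using (Level; _⊔_) renaming (suc to lsuc)
open import Data.List.Base using (List)
open import Data.List.Membership.Propositional using () renaming (_∈_ to _∈ₗ_)
open import Data.Nat.Base using (ℕ)
open import Data.Product.Base using (Σ; ∃; _×_; _,_)
open import Data.Unit.Polymorphic.Base using (⊤)
open import Data.Vec.Base using (Vec; []; _∷_; map)
open import Data.Vec.Relation.Binary.Pointwise.Inductive using (Pointwise; Pointwise-≡⇒≡)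
open import Data.Vec.Relation.Unary.Any using (Any)
open import Function.Base using (const)
open import Function.Bundles using (Func; _⇔_)
open import Function.Definitions using (Injective)
open import Relation.Binary.Bundles using (Setoid)
open import Relation.Binary.PropositionalEquality using (_≡_; cong; setoid)
open import Relation.Unary using (Pred; _∈_; _⊆_; _∪_)

-- One level ℓ plays the role of "sets": symbols, variables, carriers of
-- structures and subsets of Fm X all live at ℓ.

record Signature (ℓ : Level) : Set (lsuc ℓ) where
  field
    Op    : Set ℓ
    arity : Op → ℕ

open Signature public

data Fm {ℓ} (S : Signature ℓ) (X : Set ℓ) : Set ℓ where
  var : X → Fm S X
  op  : (f : Op S) → Vec (Fm S X) (arity S f) → Fm S X

data _∈var_ {ℓ} {S : Signature ℓ} {X : Set ℓ} (x : X) : Fm S X → Set ℓ where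
  here : x ∈var var x
  arg  : ∀ {f φs} → Any (x ∈var_) φs → x ∈var op f φs

module _ {ℓ} {S : Signature ℓ} {X Y : Set ℓ} where

  mutual
    sub : (X → Fm S Y) → Fm S X → Fm S Y
    sub σ (var x)   = σ x
    sub σ (op f φs) = op f (subs σ φs)

    subs : ∀ {n} → (X → Fm S Y) → Vec (Fm S X) n → Vec (Fm S Y) n
    subs σ []       = []
    subs σ (φ ∷ φs) = sub σ φ ∷ subs σ φs

-- Carriers are setoids, so that the class of structures is closed under
-- quotients; equality of elements always means _≈_.

record Structure {ℓ} (S : Signature ℓ) : Set (lsuc ℓ) where
  field
    carrier : Setoid ℓ ℓ
  open Setoid carrier public
  field
    ⟦_⟧     : (f : Op S) → Vec Carrier (arity S f) → Carrier
    ⟦⟧-cong : ∀ f {as bs} → Pointwise _≈_ as bs → ⟦ f ⟧ as ≈ ⟦ f ⟧ bs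

record Hom {ℓ} {S : Signature ℓ} (A B : Structure S) : Set ℓ where
  private
    module A = Structure A
    module B = Structure B
  field
    func : Func A.carrier B.carrier
  open Func func public using (to)
  field
    homo : ∀ f (as : Vec A.Carrier (arity S f)) →
           to (A.⟦ f ⟧ as) B.≈ B.⟦ f ⟧ (map to as)

open Hom public using (to)

IsInjective : ∀ {ℓ} {S : Signature ℓ} {A B : Structure S} → Hom A B → Set ℓ
IsInjective {A = A} {B} h = Injective (Structure._≈_ A) (Structure._≈_ B) (to h)

FmStr : ∀ {ℓ} (S : Signature ℓ) (X : Set ℓ) → Structure S
FmStr S X = record
  { carrier = setoid (Fm S X)
  ; ⟦_⟧     = op
  ; ⟦⟧-cong = λ f ps → cong (op f) (Pointwise-≡⇒≡ ps)
  }

Equation : ∀ {ℓ} → Signature ℓ → Set ℓ → Set ℓ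
Equation S X = Fm S X × Fm S X

IsRegular : ∀ {ℓ} {S : Signature ℓ} {X : Set ℓ} → Equation S X → Set ℓ
IsRegular (φ , ψ) = ∀ x → (x ∈var φ) ⇔ (x ∈var ψ)

module _ {ℓ} {S : Signature ℓ} where

  Satisfies : ∀ {X} (A : Structure S) → Hom (FmStr S X) A → Equation S X → Set ℓ
  Satisfies A h (φ , ψ) = Structure._≈_ A (to h φ) (to h ψ)

  Models : ∀ {X} → Structure S → Pred (Equation S X) ℓ → Set ℓ
  Models {X} A E = ∀ e → e ∈ E → (h : Hom (FmStr S X) A) → Satisfies A h e

  -- The set Y of variables used to axiomatise K is independent of the set of
  -- variables over which a logic is considered: the latter may be finite, and
  -- then would not suffice to axiomatise every variety.
  IsRegularVariety : ∀ {k} → Pred (Structure S) k → Set (lsuc ℓ ⊔ k)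
  IsRegularVariety K =
    Σ (Set ℓ) λ Y → Σ (Pred (Equation S Y) ℓ) λ E →
      (∀ e → e ∈ E → IsRegular e) × (∀ A → (A ∈ K) ⇔ Models A E)

  Amalgamation : ∀ {k} → Pred (Structure S) k → Set (lsuc ℓ ⊔ k)
  Amalgamation K =
    ∀ (A B C : Structure S) → A ∈ K → B ∈ K → C ∈ K →
    (iB : Hom A B) (iC : Hom A C) → IsInjective iB → IsInjective iC →
    Σ (Structure S) λ D → D ∈ K ×
      Σ (Hom B D) λ eB → Σ (Hom C D) λ eC →
        IsInjective eB × IsInjective eC ×
        (∀ a → Structure._≈_ D (to eB (to iB a)) (to eC (to iC a)))

  Entails : ∀ {k X} → Pred (Structure S) k →
            Pred (Equation S X) ℓ → Equation S X → Set (lsuc ℓ ⊔ k)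
  Entails {X = X} K Θ e =
    ∀ A → A ∈ K → (h : Hom (FmStr S X) A) →
    (∀ t → t ∈ Θ → Satisfies A h t) → Satisfies A h e

module _ {ℓ} {S : Signature ℓ} {X : Set ℓ} where

  image : (Fm S X → Fm S X) → Pred (Fm S X) ℓ → Pred (Fm S X) ℓ
  image g Γ ψ = ∃ λ γ → γ ∈ Γ × ψ ≡ g γ

  varOf : Pred (Fm S X) ℓ → Pred X ℓ
  varOf Γ x = ∃ λ γ → γ ∈ Γ × x ∈var γ

record Logic {ℓ} (S : Signature ℓ) (X : Set ℓ) (l : Level) : Set (lsuc (ℓ ⊔ l)) where
  infix 4 _⊢_
  field
    _⊢_ : Pred (Fm S X) ℓ → Fm S X → Set l
    reflexive    : ∀ {Γ : Pred (Fm S X) ℓ} {φ} → φ ∈ Γ → Γ ⊢ φ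
    monotone     : ∀ {Γ Δ : Pred (Fm S X) ℓ} {φ} → Γ ⊆ Δ → Γ ⊢ φ → Δ ⊢ φ
    cut          : ∀ {Γ Δ : Pred (Fm S X) ℓ} {φ} → (∀ ψ → ψ ∈ Δ → Γ ⊢ ψ) → (Γ ∪ Δ) ⊢ φ → Γ ⊢ φ
    finitary     : ∀ {Γ : Pred (Fm S X) ℓ} {φ} → Γ ⊢ φ →
                   Σ (List (Fm S X)) λ γs → (_∈ₗ γs) ⊆ Γ × (_∈ₗ γs) ⊢ φ
    substitution : ∀ {Γ : Pred (Fm S X) ℓ} {φ} (σ : X → Fm S X) → Γ ⊢ φ → image (sub σ) Γ ⊢ sub σ φ

module _ {ℓ} {S : Signature ℓ} where

  -- A formula in at most one variable is a formula over ⊤; δ ⟨ φ ⟩ is δ(φ).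
  _⟨_⟩ : ∀ {X} → Fm S ⊤ → Fm S X → Fm S X
  δ ⟨ φ ⟩ = sub (const φ) δ

  _⟪_⟫ : ∀ {X} → Equation S ⊤ → Fm S X → Equation S X
  (δ , ε) ⟪ φ ⟫ = δ ⟨ φ ⟩ , ε ⟨ φ ⟩

  HasAlgebraicSemantics : ∀ {X l k} → Logic S X l → Pred (Structure S) k →
                          Equation S ⊤ → Set (lsuc ℓ ⊔ l ⊔ k)
  HasAlgebraicSemantics {X} L K τ =
    ∀ (Γ : Pred (Fm S X) ℓ) (φ : Fm S X) →
      (Γ ⊢ φ) ⇔ Entails K (λ e → ∃ λ γ → γ ∈ Γ × e ≡ τ ⟪ γ ⟫) (τ ⟪ φ ⟫)
    where open Logic L

  CraigInterpolation : ∀ {X l} → Logic S X l → Set (lsuc ℓ ⊔ l)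
  CraigInterpolation {X} L =
    ∀ (Γ : Pred (Fm S X) ℓ) (φ : Fm S X) → Γ ⊢ φ →
      Σ (Pred (Fm S X) ℓ) λ Γ′ →
        (∀ x → x ∈ varOf Γ′ → x ∈ varOf Γ × x ∈var φ) ×
        (∀ γ′ → γ′ ∈ Γ′ → Γ ⊢ γ′) ×
        (Γ′ ⊢ φ)
    where open Logic L

{-# OPTIONS --safe #-}

-- Regular equations survive adjoining an absorbing element ∞ to a structure.
-- Sending every variable outside φ to ∞ makes the premises with such a variable
-- hold trivially, as both sides of τ become ∞; so φ already follows from the
-- premises all of whose variables occur in φ, and these are the interpolant.
-- The exception is an equation τ without variables, for which every formula has
-- the same instance of τ, so that premises may be replaced by closed formulas.

module Submission where

open import Defs
open import Relation.Unary using (Pred)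
open import Data.Unit.Polymorphic.Base using (⊤; tt)

open import Data.Product.Base using (∃; _×_; _,_; proj₁; proj₂)
open import Data.Vec.Base using (Vec; []; _∷_; map)
open import Data.Vec.Properties using (map-∘; map-id)
open import Data.Vec.Relation.Binary.Pointwise.Inductive using (Pointwise; []; _∷_)
open import Data.Vec.Relation.Unary.Any as Any using (Any; here; there)
open import Function.Base using (_∘_; const)
open import Function.Bundles using (_⇔_; mk⇔; module Equivalence)
open import Relation.Binary.PropositionalEquality
  using (_≡_; refl; sym; trans; cong; cong₂; subst₂)
open import Relation.Nullary using (Dec; yes; no; contradiction)
open import Relation.Nullary.Decidable using (map′; _⊎-dec_)
open import Relation.Unary using (_∈_)

open Equivalence using () renaming (to to ⇒; from to ⇐)

module _ {ℓ} {S : Signature ℓ} where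

  infix 4 _⊆var_
  _⊆var_ : ∀ {X : Set ℓ} → Fm S X → Pred X ℓ → Set ℓ
  t ⊆var V = ∀ x → x ∈var t → x ∈ V

  -- Variables under substitution.

  module _ {X Y : Set ℓ} {σ : X → Fm S Y} where

    mutual
      ∈var-sub⁺ : ∀ {x y t} → x ∈var t → y ∈var σ x → y ∈var sub σ t
      ∈var-sub⁺ here    q = q
      ∈var-sub⁺ (arg p) q = arg (∈var-subs⁺ p q)

      ∈var-subs⁺ : ∀ {n x y} {ts : Vec (Fm S X) n} →
                   Any (x ∈var_) ts → y ∈var σ x → Any (y ∈var_) (subs σ ts)
      ∈var-subs⁺ (here p)  q = here (∈var-sub⁺ p q)
      ∈var-subs⁺ (there p) q = there (∈var-subs⁺ p q)

    mutual
      ∈var-sub⁻ : ∀ {y} t → y ∈var sub σ t → ∃ λ x → x ∈var t × y ∈var σ x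
      ∈var-sub⁻ (var x) q = x , here , q
      ∈var-sub⁻ (op f ts) (arg q) with ∈var-subs⁻ ts q
      ... | x , p , r = x , arg p , r

      ∈var-subs⁻ : ∀ {n y} (ts : Vec (Fm S X) n) → Any (y ∈var_) (subs σ ts) →
                   ∃ λ x → Any (x ∈var_) ts × y ∈var σ x
      ∈var-subs⁻ (t ∷ ts) (here q) with ∈var-sub⁻ t q
      ... | x , p , r = x , here p , r
      ∈var-subs⁻ (t ∷ ts) (there q) with ∈var-subs⁻ ts q
      ... | x , p , r = x , there p , r

  module _ {X Y : Set ℓ} {σ ρ : X → Fm S Y} where

    mutual
      sub-cong : ∀ t → (∀ x → x ∈var t → σ x ≡ ρ x) → sub σ t ≡ sub ρ t
      sub-cong (var x)   eq = eq x here
      sub-cong (op f ts) eq = cong (op f) (subs-cong ts (λ x → eq x ∘ arg))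

      subs-cong : ∀ {n} (ts : Vec (Fm S X) n) →
                  (∀ x → Any (x ∈var_) ts → σ x ≡ ρ x) → subs σ ts ≡ subs ρ ts
      subs-cong []       eq = refl
      subs-cong (t ∷ ts) eq =
        cong₂ _∷_ (sub-cong t (λ x → eq x ∘ here)) (subs-cong ts (λ x → eq x ∘ there))

  mutual
    -- The split on whether τ contains its variable is constructive: every variable of a formula
    -- over `⊤` is `tt`, so no equality test on variables arises.
    tt∈var? : (t : Fm S ⊤) → Dec (tt ∈var t)
    tt∈var? (var tt)  = yes here
    tt∈var? (op f ts) = map′ arg (λ { (arg p) → p }) (tt∈vars? ts)

    tt∈vars? : ∀ {n} (ts : Vec (Fm S ⊤) n) → Dec (Any (tt ∈var_) ts)
    tt∈vars? []       = no λ ()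
    tt∈vars? (t ∷ ts) = map′ Any.fromSum Any.toSum (tt∈var? t ⊎-dec tt∈vars? ts)

  -- Evaluation of formulas in a structure.

  module _ {X : Set ℓ} (A : Structure S) where
    open Structure A using (Carrier; _≈_; ⟦_⟧; ⟦⟧-cong)
      renaming (refl to ≈-refl; trans to ≈-trans; reflexive to ≈-reflexive)

    mutual
      eval : (X → Carrier) → Fm S X → Carrier
      eval θ (var x)   = θ x
      eval θ (op f ts) = ⟦ f ⟧ (evals θ ts)

      evals : ∀ {n} → (X → Carrier) → Vec (Fm S X) n → Vec Carrier n
      evals θ []       = []
      evals θ (t ∷ ts) = eval θ t ∷ evals θ ts

    evals≡map : ∀ {n} θ (ts : Vec (Fm S X) n) → evals θ ts ≡ map (eval θ) ts
    evals≡map θ []       = refl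
    evals≡map θ (t ∷ ts) = cong (eval θ t ∷_) (evals≡map θ ts)

    evalHom : (X → Carrier) → Hom (FmStr S X) A
    evalHom θ = record
      { func = record { to = eval θ ; cong = ≈-reflexive ∘ cong (eval θ) }
      ; homo = λ f ts → ≈-reflexive (cong ⟦ f ⟧ (evals≡map θ ts))
      }

    module _ (h : Hom (FmStr S X) A) where

      mutual
        -- By freeness of the formula algebra; this reduces satisfaction under an arbitrary
        -- homomorphism to computing with `eval`.
        hom≈eval : ∀ t → to h t ≈ eval (to h ∘ var) t
        hom≈eval (var x)   = ≈-refl
        hom≈eval (op f ts) = ≈-trans (Hom.homo h f ts) (⟦⟧-cong f (homs≈evals ts))

        homs≈evals : ∀ {n} (ts : Vec (Fm S X) n) →
                     Pointwise _≈_ (map (to h) ts) (evals (to h ∘ var) ts)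
        homs≈evals []       = []
        homs≈evals (t ∷ ts) = hom≈eval t ∷ homs≈evals ts

  -- A with an absorbing ∞ adjoined. As membership in V need not be decidable,
  -- an element is a pair (t , a) standing for a when all variables of t lie in V
  -- and for ∞ otherwise.

  module Absorbing {X : Set ℓ} (V : Pred X ℓ) (A : Structure S) where
    private module A = Structure A

    Finite : Fm S X → Set ℓ
    Finite t = t ⊆var V

    Carrier∞ : Set ℓ
    Carrier∞ = Fm S X × A.Carrier

    infix 4 _≈∞_
    -- Values count only on finite pairs, so all pairs that are not finite fall into one class, the
    -- element ∞.
    _≈∞_ : Carrier∞ → Carrier∞ → Set ℓ
    (t , a) ≈∞ (u , b) = Finite t ⇔ Finite u × (Finite t → a A.≈ b)

    -- The first component collects the variables of all arguments, which makes ∞ absorbing.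
    ⟦_⟧∞ : ∀ f → Vec Carrier∞ (arity S f) → Carrier∞
    ⟦ f ⟧∞ bs = op f (map proj₁ bs) , A.⟦ f ⟧ (map proj₂ bs)

    Finites : ∀ {n} → Vec Carrier∞ n → Set ℓ
    Finites bs = ∀ x → Any (x ∈var_) (map proj₁ bs) → x ∈ V

    Finites-resp : ∀ {n} {bs cs : Vec Carrier∞ n} →
                   Pointwise _≈∞_ bs cs → Finites bs → Finites cs
    Finites-resp ((eq , _) ∷ eqs) fin x (here p)  = ⇒ eq (λ y → fin y ∘ here) x p
    Finites-resp (_ ∷ eqs)        fin x (there p) =
      Finites-resp eqs (λ y → fin y ∘ there) x p

    ≈∞-sym : ∀ {b c} → b ≈∞ c → c ≈∞ b
    ≈∞-sym (eq , val) = mk⇔ (⇐ eq) (⇒ eq) , A.sym ∘ val ∘ ⇐ eq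

    ≈∞-syms : ∀ {n} {bs cs : Vec Carrier∞ n} → Pointwise _≈∞_ bs cs → Pointwise _≈∞_ cs bs
    ≈∞-syms []         = []
    ≈∞-syms (eq ∷ eqs) = ≈∞-sym eq ∷ ≈∞-syms eqs

    values-≈ : ∀ {n} {bs cs : Vec Carrier∞ n} → Pointwise _≈∞_ bs cs → Finites bs →
               Pointwise A._≈_ (map proj₂ bs) (map proj₂ cs)
    values-≈ []               fin = []
    values-≈ ((_ , val) ∷ eqs) fin =
      val (λ x → fin x ∘ here) ∷ values-≈ eqs (λ x → fin x ∘ there)

    A∞ : Structure S
    A∞ = record
      { carrier = record
        { Carrier = Carrier∞
        ; _≈_ = _≈∞_
        ; isEquivalence = record
          { refl  = mk⇔ (λ p → p) (λ p → p) , λ _ → A.refl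
          ; sym   = ≈∞-sym
          ; trans = λ (eq , val) (eq′ , val′) →
              mk⇔ (λ fin → ⇒ eq′ (⇒ eq fin)) (λ fin → ⇐ eq (⇐ eq′ fin)) ,
              λ fin → A.trans (val fin) (val′ (⇒ eq fin))
          }
        }
      ; ⟦_⟧ = ⟦_⟧∞
      ; ⟦⟧-cong = λ f eqs →
          mk⇔ (λ { fin x (arg p) → Finites-resp eqs (λ y → fin y ∘ arg) x p })
              (λ { fin x (arg p) → Finites-resp (≈∞-syms eqs) (λ y → fin y ∘ arg) x p }) ,
          λ fin → A.⟦⟧-cong f (values-≈ eqs (λ x → fin x ∘ arg))
      }

    private module A∞ = Structure A∞

    module _ {Y : Set ℓ} (θ : Y → Carrier∞) where

      mutual
        -- Operations act componentwise, so an equation in `A∞` splits into a condition on variables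
        -- and an equation in `A`.
        eval-∞ : ∀ t → eval A∞ θ t ≡ (sub (proj₁ ∘ θ) t , eval A (proj₂ ∘ θ) t)
        eval-∞ (var y)   = refl
        eval-∞ (op f ts) =
          cong₂ (λ us as → op f us , A.⟦ f ⟧ as) (evals-∞₁ ts) (evals-∞₂ ts)

        evals-∞₁ : ∀ {n} (ts : Vec (Fm S Y) n) →
                   map proj₁ (evals A∞ θ ts) ≡ subs (proj₁ ∘ θ) ts
        evals-∞₁ []       = refl
        evals-∞₁ (t ∷ ts) = cong₂ _∷_ (cong proj₁ (eval-∞ t)) (evals-∞₁ ts)

        evals-∞₂ : ∀ {n} (ts : Vec (Fm S Y) n) →
                   map proj₂ (evals A∞ θ ts) ≡ evals A (proj₂ ∘ θ) ts
        evals-∞₂ []       = refl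
        evals-∞₂ (t ∷ ts) = cong₂ _∷_ (cong proj₂ (eval-∞ t)) (evals-∞₂ ts)

    Finite-sub-mono : ∀ {Y : Set ℓ} {σ : Y → Fm S X} {s t} →
                      t ⊆var (_∈var s) → Finite (sub σ s) → Finite (sub σ t)
    Finite-sub-mono {t = t} t⊆s fin x p with ∈var-sub⁻ t p
    ... | y , y∈t , q = fin x (∈var-sub⁺ (t⊆s y y∈t) q)

    Finite-sub-regular : ∀ {Y : Set ℓ} {e : Equation S Y} → IsRegular e → (σ : Y → Fm S X) →
                         Finite (sub σ (proj₁ e)) ⇔ Finite (sub σ (proj₂ e))
    Finite-sub-regular reg σ =
      mk⇔ (Finite-sub-mono (⇐ ∘ reg)) (Finite-sub-mono (⇒ ∘ reg))

    Models-∞ : ∀ {Y : Set ℓ} {E : Pred (Equation S Y) ℓ} →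
               (∀ e → e ∈ E → IsRegular e) → Models A E → Models A∞ E
    Models-∞ regular models e@(s , t) e∈E g =
      A∞.trans (hom≈eval A∞ g s) (A∞.trans eval-eq (A∞.sym (hom≈eval A∞ g t)))
      where
      θ = to g ∘ var
      eval-eq : eval A∞ θ s ≈∞ eval A∞ θ t
      eval-eq = subst₂ _≈∞_ (sym (eval-∞ θ s)) (sym (eval-∞ θ t))
        -- Regularity makes both sides reach ∞ together; the second components of `θ` form an
        -- assignment in `A`, where `e` holds.
        ( Finite-sub-regular (regular e e∈E) (proj₁ ∘ θ)
        , λ _ → models e e∈E (evalHom A (proj₂ ∘ θ)))

    -- The assignment h, with the variables outside V sent to ∞.
    hom-∞ : Hom (FmStr S X) A → Hom (FmStr S X) A∞
    hom-∞ h = record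
      { func = record { to = λ t → t , to h t ; cong = λ { refl → A∞.refl } }
      ; homo = homo-∞
      }
      where
      map-proj₁ : ∀ {n} (ts : Vec (Fm S X) n) → map proj₁ (map (λ t → t , to h t) ts) ≡ ts
      map-proj₁ ts = trans (sym (map-∘ proj₁ _ ts)) (map-id ts)

      homo-∞ : ∀ f ts → (op f ts , to h (op f ts)) ≈∞ ⟦ f ⟧∞ (map (λ t → t , to h t) ts)
      homo-∞ f ts rewrite map-proj₁ ts | sym (map-∘ proj₂ (λ t → t , to h t) ts) =
        mk⇔ (λ p → p) (λ p → p) , λ _ → Hom.homo h f ts

  ⟨⟩-⊆var : ∀ {X : Set ℓ} (δ : Fm S ⊤) {γ : Fm S X} → δ ⟨ γ ⟩ ⊆var (_∈var γ)
  ⟨⟩-⊆var δ x = proj₂ ∘ proj₂ ∘ ∈var-sub⁻ δ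

  -- If τ has no variable then τ ⟪ γ ⟫ does not depend on γ, and the formula
  -- δ ⟨ γ ⟩ is closed.
  shrink : ∀ {X : Set ℓ} {V : Pred X ℓ} {τ : Equation S ⊤} → IsRegular τ → (γ : Fm S X) →
           proj₁ τ ⟨ γ ⟩ ⊆var V →
           ∃ λ ψ → ψ ⊆var (_∈var γ) × ψ ⊆var V × τ ⟪ ψ ⟫ ≡ τ ⟪ γ ⟫
  shrink {τ = δ , ε} reg γ δγ⊆V with tt∈var? δ
  -- Every variable of `γ` survives in `δ ⟨ γ ⟩`, so `γ` itself serves.
  ... | yes tt∈δ = γ , (λ _ p → p) , (λ x p → δγ⊆V x (∈var-sub⁺ tt∈δ p)) , refl
  ... | no  tt∉δ = δ ⟨ γ ⟩ , ⟨⟩-⊆var δ , δγ⊆V ,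
    cong₂ _,_ (sub-cong δ λ _ p → contradiction p tt∉δ)
              (sub-cong ε λ _ p → contradiction (⇐ (reg _) p) tt∉δ)

corollary5p16 : ∀ {ℓ k l} (S : Signature ℓ) (K : Pred (Structure S) k) →
    IsRegularVariety K → Amalgamation K →
    ∀ (X : Set ℓ) (L : Logic S X l) (τ : Equation S ⊤) →
    IsRegular τ → HasAlgebraicSemantics L K τ →
    CraigInterpolation L
corollary5p16 S K (Y , E , regular , K⇔E) _ X L τ@(δ , ε) τ-reg semantics Γ φ Γ⊢φ =
  Γ′ , shared , derivable , ⇐ (semantics Γ′ φ) entails
  where
  open Logic L
  V : Pred X _
  V = _∈var φ

  -- Under the semantics a premise matters only through its instance of τ. Collecting every formula
  -- with the right instance and variables avoids choosing one per premise.
  Γ′ : Pred (Fm S X) _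
  Γ′ ψ = ∃ λ γ → γ ∈ Γ × ψ ⊆var (_∈var γ) × ψ ⊆var V × τ ⟪ ψ ⟫ ≡ τ ⟪ γ ⟫

  shared : ∀ x → x ∈ varOf Γ′ → x ∈ varOf Γ × x ∈ V
  shared x (ψ , (γ , γ∈Γ , ψ⊆γ , ψ⊆V , _) , x∈ψ) = (γ , γ∈Γ , ψ⊆γ x x∈ψ) , ψ⊆V x x∈ψ

  derivable : ∀ ψ → ψ ∈ Γ′ → Γ ⊢ ψ
  derivable ψ (γ , γ∈Γ , _ , _ , eq) =
    ⇐ (semantics Γ ψ) λ A A∈K h sat → sat _ (γ , γ∈Γ , eq)

  entails : Entails K (λ e → ∃ λ ψ → ψ ∈ Γ′ × e ≡ τ ⟪ ψ ⟫) (τ ⟪ φ ⟫)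
  entails A A∈K h sat =
    -- The conclusion has only variables of `φ`, hence is finite, and its equality in `A∞` yields
    -- one in `A`.
    proj₂ (⇒ (semantics Γ φ) Γ⊢φ A∞ A∞∈K (hom-∞ h) sat-∞) (⟨⟩-⊆var δ)
    where
    open Absorbing V A
    A∞∈K : A∞ ∈ K
    A∞∈K = ⇐ (K⇔E A∞) (Models-∞ regular (⇒ (K⇔E A) A∈K))

    sat-∞ : ∀ e → (∃ λ γ → γ ∈ Γ × e ≡ τ ⟪ γ ⟫) → Satisfies A∞ (hom-∞ h) e
    -- Both sides of the premise are ∞, or both are finite and `shrink` supplies a member of `Γ′`
    -- with the same instance.
    sat-∞ _ (γ , γ∈Γ , refl) = Finite-sub-regular τ-reg (const γ) , val
      where
      val : Finite (δ ⟨ γ ⟩) → Satisfies A h (τ ⟪ γ ⟫)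
      val fin with shrink τ-reg γ fin
      ... | ψ , ψ⊆γ , ψ⊆V , eq = sat _ (ψ , (γ , γ∈Γ , ψ⊆γ , ψ⊆V , eq) , sym eq)
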